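{- (Subject reduction for $\lambda^{\textsc{prk}}$.) For every typing context $\Gamma$, all terms $t,s$ and every type $P$ of $\lambda^{\textsc{prk}}$: if $\Gamma\vdash t:P$ and $t\to s$, then $\Gamma\vdash s:P$.
   Context: **Types.** Fix a denumerable set of propositional variables $\alpha$. Pure propositions: $A,B ::= \alpha \mid A\land B\mid A\lor B\mid \neg A$. Types (moded propositions): $P,Q ::= A^+\mid A^-\mid A^\oplus\mid A^\ominus$; $A^+,A^-$ are strong, $A^\oplus,A^\ominus$ classical. Opposite: $(A^+)^\sim=A^-$, $(A^-)^\sim=A^+$, $(A^\oplus)^\sim=A^\ominus$, $(A^\ominus)^\sim=A^\oplus$. **Terms of $\lambda^{\textsc{prk}}$.** ($i\in\{1,2\}$, $\pm\in\{+,-\}$; $x,y$ from a denumerable set of variables) $$t,s,u ::= x \mid t\blacktriangleright\!\blacktriangleleft_P s\mid \langle t,s\rangle^\pm\mid \pi_i^\pm(t)\mid \mathsf{in}_i^\pm(t)\mid \delta^\pm t[_{x:P}.s][_{y:Q}.u]\mid \nu^\pm t\mid \mu^\pm t\mid \mathsf{IC}^\pm_{(x:P)}.t\mid t\bullet^\pm s.$$ In $\delta^\pm t[_{x:P}.s][_{y:Q}.u]$, $x$ is bound in $s$ and $y$ in $u$; in $\mathsf{IC}^\pm_{(x:P)}.t$, $x$ is bound in $t$. Terms are taken modulo $\alpha$-renaming; $t[x:=s]$ is capture-avoiding substitution. Type annotations may be omitted. **Typing.** Typing contexts $\Gamma$ are finite lists $x_1:P_1,\dots,x_n:P_n$ with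 distinct variables, up to reordering. Rules: - (Ax) $\Gamma,x:P\vdash x:P$. (Abs) $\Gamma\vdash t:P$, $\Gamma\vdash s:P^\sim$, $P$ strong $\Rightarrow$ $\Gamma\vdash t\blacktriangleright\!\blacktriangleleft_Q s:Q$. - $\Gamma\vdash t:A^\oplus$, $\Gamma\vdash s:B^\oplus$ $\Rightarrow$ $\Gamma\vdash\langle t,s\rangle^+:(A\land B)^+$. $\Gamma\vdash t:A^\ominus$, $\Gamma\vdash s:B^\ominus$ $\Rightarrow$ $\Gamma\vdash\langle t,s\rangle^-:(A\lor B)^-$. - $\Gamma\vdash t:(A_1\land A_2)^+$ $\Rightarrow$ $\Gamma\vdash\pi^+_i(t):A_i^\oplus$. $\Gamma\vdash t:(A_1\lor A_2)^-$ $\Rightarrow$ $\Gamma\vdash\pi^-_i(t):A_i^\ominus$. - $\Gamma\vdash t:A_i^\oplus$ $\Rightarrow$ $\Gamma\vdash\mathsf{in}^+_i(t):(A_1\lor A_2)^+$. $\Gamma\vdash t:A_i^\ominus$ $\Rightarrow$ $\Gamma\vdash\mathsf{in}^-_i(t):(A_1\land A_2)^-$. - $\Gamma\vdash t:(A\lor B)^+$, $\Gamma,x:A^\oplus\vdash s:P$, $\Gamma,y:B^\oplus\vdash u:P$ $\Rightarrow$ $\Gamma\vdash\delta^+t[_{x:A^\oplus}.s][_{y:B^\oplus}.u]:P$. $\Gamma\vdash t:(A\land B)^-$, $\Gamma,x:A^\ominus\vdash s:P$, $\Gamma,y:B^\ominus\vdash u:P$ $\Rightarrow$ $\Gamma\vdash\delta^-t[_{x:A^\ominus}.s][_{y:B^\ominus}.u]:P$.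 - $\Gamma\vdash t:A^\ominus$ $\Rightarrow$ $\Gamma\vdash\nu^+t:(\neg A)^+$. $\Gamma\vdash t:A^\oplus$ $\Rightarrow$ $\Gamma\vdash\nu^-t:(\neg A)^-$. $\Gamma\vdash t:(\neg A)^+$ $\Rightarrow$ $\Gamma\vdash\mu^+t:A^\ominus$. $\Gamma\vdash t:(\neg A)^-$ $\Rightarrow$ $\Gamma\vdash\mu^-t:A^\oplus$. - $\Gamma,x:A^\ominus\vdash t:A^+$ $\Rightarrow$ $\Gamma\vdash\mathsf{IC}^+_{(x:A^\ominus)}.t:A^\oplus$. $\Gamma,x:A^\oplus\vdash t:A^-$ $\Rightarrow$ $\Gamma\vdash\mathsf{IC}^-_{(x:A^\oplus)}.t:A^\ominus$. - $\Gamma\vdash t:A^\oplus$, $\Gamma\vdash s:A^\ominus$ $\Rightarrow$ $\Gamma\vdash t\bullet^+s:A^+$. $\Gamma\vdash t:A^\ominus$, $\Gamma\vdash s:A^\oplus$ $\Rightarrow$ $\Gamma\vdash t\bullet^-s:A^-$. **Generalized absurdity.** For $t:P$ and $s:P^\sim$, $t\bowtie_Q s$ denotes: $t\blacktriangleright\!\blacktriangleleft_Q s$ if $P$ is strong; $(t\bullet^+s)\blacktriangleright\!\blacktriangleleft_Q(s\bullet^-t)$ if $P=A^\oplus$; $(t\bullet^-s)\blacktriangleright\!\blacktriangleleft_Q(s\bullet^+t)$ if $P=A^\ominus$. **Reduction.** $\to$ is defined on typable terms as the closure under arbitrary contexts of the following rules (in each rule all $\pm$ denote the same sign, $\mp$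 the opposite sign, and $i\in\{1,2\}$): - $\pi_i^\pm(\langle t_1,t_2\rangle^\pm)\to t_i$; - $\delta^\pm(\mathsf{in}_i^\pm(t))[_x.s_1][_x.s_2]\to s_i[x:=t]$; - $\mu^\pm(\nu^\pm t)\to t$; - $(\mathsf{IC}^\pm_x.t)\bullet^\pm s\to t[x:=s]$; - $\langle t_1,t_2\rangle^\pm\blacktriangleright\!\blacktriangleleft_Q\mathsf{in}_i^\mp(s)\to t_i\bowtie_Q s$; - $\mathsf{in}_i^\pm(t)\blacktriangleright\!\blacktriangleleft_Q\langle s_1,s_2\rangle^\mp\to t\bowtie_Q s_i$; - $(\nu^\pm t)\blacktriangleright\!\blacktriangleleft_Q(\nu^\mp s)\to t\bowtie_Q s$. -}

module Defs where

open import Data.Fin.Base using (Fin; zero; suc)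
open import Data.Fin.Substitution using (Lift; Sub; TermSubst)
open import Data.Nat.Base using (ℕ; suc)
open import Data.Sign.Base using (Sign; +; -; opposite)
open import Data.Vec.Base using (Vec; _∷_; lookup)

private
  variable
    n : ℕ

-- The indices 1 and 2 are zero and suc zero in Fin 2.

pick : {X : Set} → Fin 2 → X → X → X
pick zero       x₁ x₂ = x₁
pick (suc zero) x₁ x₂ = x₂

infixr 7 _∧_
infixr 6 _∨_
infix  8 `¬_

data PureProp : Set where
  atom    : ℕ → PureProp
  _∧_ _∨_ : PureProp → PureProp → PureProp
  `¬_     : PureProp → PureProp

infix 5 _⁺ _⁻ _⊕ _⊖

data Type : Set where
  _⁺ _⁻ : PureProp → Type
  _⊕ _⊖ : PureProp → Type

infix 9 _~

_~ : Type → Type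
(A ⁺) ~ = A ⁻
(A ⁻) ~ = A ⁺
(A ⊕) ~ = A ⊖
(A ⊖) ~ = A ⊕

data Strong : Type → Set where
  strong⁺ : ∀ {A} → Strong (A ⁺)
  strong⁻ : ∀ {A} → Strong (A ⁻)

-- Terms up to α-renaming are represented by well-scoped de Bruijn terms.
-- In δ p t P s Q u a variable of type P is bound in s and one of type Q
-- in u; in IC p P t a variable of type P is bound in t.

infix 6 _▶◀[_]_
infix 7 _•[_]_

data Term (n : ℕ) : Set where
  var      : Fin n → Term n
  _▶◀[_]_  : Term n → Type → Term n → Term n
  ⟨_,_⟩[_] : Term n → Term n → Sign → Term n
  π        : Sign → Fin 2 → Term n → Term n
  inj      : Sign → Fin 2 → Term n → Term n
  δ        : Sign → Term n → Type → Term (suc n) → Type → Term (suc n) → Term n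
  ν        : Sign → Term n → Term n
  μ        : Sign → Term n → Term n
  IC       : Sign → Type → Term (suc n) → Term n
  _•[_]_   : Term n → Sign → Term n → Term n

module TermApp {T : ℕ → Set} (l : Lift T Term) where
  open Lift l using (lift; _↑)

  infixl 8 _/_

  _/_ : ∀ {m n} → Term m → Sub T m n → Term n
  var x            / ρ = lift (lookup ρ x)
  (t ▶◀[ P ] s)    / ρ = (t / ρ) ▶◀[ P ] (s / ρ)
  ⟨ t , s ⟩[ p ]   / ρ = ⟨ t / ρ , s / ρ ⟩[ p ]
  π p i t          / ρ = π p i (t / ρ)
  inj p i t        / ρ = inj p i (t / ρ)
  δ p t P s Q u    / ρ = δ p (t / ρ) P (s / ρ ↑) Q (u / ρ ↑)
  ν p t            / ρ = ν p (t / ρ)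
  μ p t            / ρ = μ p (t / ρ)
  IC p P t         / ρ = IC p P (t / ρ ↑)
  (t •[ p ] s)     / ρ = (t / ρ) •[ p ] (s / ρ)

termSubst : TermSubst Term
termSubst = record { var = var; app = TermApp._/_ }

open TermSubst termSubst using (_/_; sub)

infix 9 _[_]

_[_] : Term (suc n) → Term n → Term n
t [ s ] = t / sub s

Ctx : ℕ → Set
Ctx = Vec Type

infix 4 _⊢_∶_

data _⊢_∶_ {n : ℕ} (Γ : Ctx n) : Term n → Type → Set where
  ax  : ∀ x → Γ ⊢ var x ∶ lookup Γ x
  abs : ∀ {t s P Q} → Strong P →
        Γ ⊢ t ∶ P → Γ ⊢ s ∶ P ~ → Γ ⊢ t ▶◀[ Q ] s ∶ Q
  I∧⁺ : ∀ {t s A B} →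
        Γ ⊢ t ∶ A ⊕ → Γ ⊢ s ∶ B ⊕ → Γ ⊢ ⟨ t , s ⟩[ + ] ∶ (A ∧ B) ⁺
  I∨⁻ : ∀ {t s A B} →
        Γ ⊢ t ∶ A ⊖ → Γ ⊢ s ∶ B ⊖ → Γ ⊢ ⟨ t , s ⟩[ - ] ∶ (A ∨ B) ⁻
  E∧⁺ : ∀ {t A₁ A₂} i →
        Γ ⊢ t ∶ (A₁ ∧ A₂) ⁺ → Γ ⊢ π + i t ∶ (pick i A₁ A₂) ⊕
  E∨⁻ : ∀ {t A₁ A₂} i →
        Γ ⊢ t ∶ (A₁ ∨ A₂) ⁻ → Γ ⊢ π - i t ∶ (pick i A₁ A₂) ⊖
  I∨⁺ : ∀ {t A₁ A₂} i →
        Γ ⊢ t ∶ (pick i A₁ A₂) ⊕ → Γ ⊢ inj + i t ∶ (A₁ ∨ A₂) ⁺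
  I∧⁻ : ∀ {t A₁ A₂} i →
        Γ ⊢ t ∶ (pick i A₁ A₂) ⊖ → Γ ⊢ inj - i t ∶ (A₁ ∧ A₂) ⁻
  E∨⁺ : ∀ {t s u A B P} →
        Γ ⊢ t ∶ (A ∨ B) ⁺ → (A ⊕) ∷ Γ ⊢ s ∶ P → (B ⊕) ∷ Γ ⊢ u ∶ P →
        Γ ⊢ δ + t (A ⊕) s (B ⊕) u ∶ P
  E∧⁻ : ∀ {t s u A B P} →
        Γ ⊢ t ∶ (A ∧ B) ⁻ → (A ⊖) ∷ Γ ⊢ s ∶ P → (B ⊖) ∷ Γ ⊢ u ∶ P →
        Γ ⊢ δ - t (A ⊖) s (B ⊖) u ∶ P
  I¬⁺ : ∀ {t A} → Γ ⊢ t ∶ A ⊖ → Γ ⊢ ν + t ∶ (`¬ A) ⁺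
  I¬⁻ : ∀ {t A} → Γ ⊢ t ∶ A ⊕ → Γ ⊢ ν - t ∶ (`¬ A) ⁻
  E¬⁺ : ∀ {t A} → Γ ⊢ t ∶ (`¬ A) ⁺ → Γ ⊢ μ + t ∶ A ⊖
  E¬⁻ : ∀ {t A} → Γ ⊢ t ∶ (`¬ A) ⁻ → Γ ⊢ μ - t ∶ A ⊕
  IC⁺ : ∀ {t A} → (A ⊖) ∷ Γ ⊢ t ∶ A ⁺ → Γ ⊢ IC + (A ⊖) t ∶ A ⊕
  IC⁻ : ∀ {t A} → (A ⊕) ∷ Γ ⊢ t ∶ A ⁻ → Γ ⊢ IC - (A ⊕) t ∶ A ⊖
  EC⁺ : ∀ {t s A} → Γ ⊢ t ∶ A ⊕ → Γ ⊢ s ∶ A ⊖ → Γ ⊢ t •[ + ] s ∶ A ⁺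
  EC⁻ : ∀ {t s A} → Γ ⊢ t ∶ A ⊖ → Γ ⊢ s ∶ A ⊕ → Γ ⊢ t •[ - ] s ∶ A ⁻

-- t ⋈[ P ⇒ Q ] s is the generalized absurdity of conclusion Q between
-- t of type P and s of type P ~.

_⋈[_⇒_]_ : Term n → Type → Type → Term n → Term n
t ⋈[ A ⁺ ⇒ Q ] s = t ▶◀[ Q ] s
t ⋈[ A ⁻ ⇒ Q ] s = t ▶◀[ Q ] s
t ⋈[ A ⊕ ⇒ Q ] s = (t •[ + ] s) ▶◀[ Q ] (s •[ - ] t)
t ⋈[ A ⊖ ⇒ Q ] s = (t •[ - ] s) ▶◀[ Q ] (s •[ + ] t)

-- Generalized absurdity depends on the type P of its first argument, so
-- the last three rules ask for a context in which the redex is typable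
-- and its components have types P and P ~. The relation is Γ-free: this
-- context need not be the one in which the reduct is later typed. For
-- the other rules typability of the redex plays no role in the
-- contractum, and it is left to the statements about reduction.

infix 4 _↦_ _⟶_

data _↦_ {n : ℕ} : Term n → Term n → Set where
  π-pair : ∀ {p i t₁ t₂} → π p i ⟨ t₁ , t₂ ⟩[ p ] ↦ pick i t₁ t₂
  δ-inj  : ∀ {p i t P s₁ Q s₂} →
           δ p (inj p i t) P s₁ Q s₂ ↦ (pick i s₁ s₂) [ t ]
  μ-ν    : ∀ {p t} → μ p (ν p t) ↦ t
  IC-•   : ∀ {p P t s} → (IC p P t) •[ p ] s ↦ t [ s ]
  pair-inj : ∀ {p i t₁ t₂ s P Q} (Γ : Ctx n) →
    Γ ⊢ ⟨ t₁ , t₂ ⟩[ p ] ▶◀[ Q ] inj (opposite p) i s ∶ Q →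
    Γ ⊢ pick i t₁ t₂ ∶ P → Γ ⊢ s ∶ P ~ →
    ⟨ t₁ , t₂ ⟩[ p ] ▶◀[ Q ] inj (opposite p) i s
      ↦ pick i t₁ t₂ ⋈[ P ⇒ Q ] s
  inj-pair : ∀ {p i t s₁ s₂ P Q} (Γ : Ctx n) →
    Γ ⊢ inj p i t ▶◀[ Q ] ⟨ s₁ , s₂ ⟩[ opposite p ] ∶ Q →
    Γ ⊢ t ∶ P → Γ ⊢ pick i s₁ s₂ ∶ P ~ →
    inj p i t ▶◀[ Q ] ⟨ s₁ , s₂ ⟩[ opposite p ]
      ↦ t ⋈[ P ⇒ Q ] pick i s₁ s₂
  ν-ν : ∀ {p t s P Q} (Γ : Ctx n) →
    Γ ⊢ ν p t ▶◀[ Q ] ν (opposite p) s ∶ Q →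
    Γ ⊢ t ∶ P → Γ ⊢ s ∶ P ~ →
    ν p t ▶◀[ Q ] ν (opposite p) s ↦ t ⋈[ P ⇒ Q ] s

data _⟶_ {n : ℕ} : Term n → Term n → Set where
  root : ∀ {t t′} → t ↦ t′ → t ⟶ t′
  ▶◀ˡ  : ∀ {t t′ P s} → t ⟶ t′ → t ▶◀[ P ] s ⟶ t′ ▶◀[ P ] s
  ▶◀ʳ  : ∀ {t P s s′} → s ⟶ s′ → t ▶◀[ P ] s ⟶ t ▶◀[ P ] s′
  ⟨⟩ˡ  : ∀ {t t′ s p} → t ⟶ t′ → ⟨ t , s ⟩[ p ] ⟶ ⟨ t′ , s ⟩[ p ]
  ⟨⟩ʳ  : ∀ {t s s′ p} → s ⟶ s′ → ⟨ t , s ⟩[ p ] ⟶ ⟨ t , s′ ⟩[ p ]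
  π    : ∀ {p i t t′} → t ⟶ t′ → π p i t ⟶ π p i t′
  inj  : ∀ {p i t t′} → t ⟶ t′ → inj p i t ⟶ inj p i t′
  δ₀   : ∀ {p t t′ P s Q u} → t ⟶ t′ → δ p t P s Q u ⟶ δ p t′ P s Q u
  δ₁   : ∀ {p t P s s′ Q u} → s ⟶ s′ → δ p t P s Q u ⟶ δ p t P s′ Q u
  δ₂   : ∀ {p t P s Q u u′} → u ⟶ u′ → δ p t P s Q u ⟶ δ p t P s Q u′
  ν    : ∀ {p t t′} → t ⟶ t′ → ν p t ⟶ ν p t′
  μ    : ∀ {p t t′} → t ⟶ t′ → μ p t ⟶ μ p t′
  IC   : ∀ {p P t t′} → t ⟶ t′ → IC p P t ⟶ IC p P t′
  •ˡ   : ∀ {t t′ p s} → t ⟶ t′ → t •[ p ] s ⟶ t′ •[ p ] s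
  •ʳ   : ∀ {t p s s′} → s ⟶ s′ → t •[ p ] s ⟶ t •[ p ] s′

{-# OPTIONS --safe #-}

-- The last three rules of _↦_ choose the contractum by a type P that t may
-- have in a context unrelated to the one in which the reduct is typed.
-- Only the mode of P matters to _⋈[_⇒_]_, and although types are not
-- unique (inj does not record the other disjunct), modes are.  The typing
-- of the redex in the context of the rule then fixes the mode from the
-- sign of the constructor.

module Submission where

open import Data.Fin.Base using (Fin; zero; suc)
open import Data.Fin.Substitution using (Lift; Sub; TermSubst)
open import Data.Fin.Substitution.Lemmas
  using (Lemmas₁; module VarLemmas)
open import Data.Nat.Base using (ℕ)
open import Data.Vec.Base using (_∷_; lookup)
open import Data.Vec.Properties using (lookup-map)
open import Relation.Binary.PropositionalEquality
  using (_≡_; refl; sym; cong; subst)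
open import Defs

private
  variable
    m n : ℕ

-- Renaming and substitution are the same traversal `_/_` at two lifts, so `⊢-/` is proved once over
-- these fields. Two instances are needed in order: weakening of terms is itself a renaming, so the
-- variable instance supplies `⊩-weaken` for the term instance.
record TypedLift {T : ℕ → Set} (l : Lift T Term) : Set₁ where
  open Lift l using (weaken; lift; _↑) renaming (var to varₗ)
  infix 4 _⊩_∶_
  field
    _⊩_∶_    : Ctx n → T n → Type → Set
    ⊩-var    : ∀ {P} {Γ : Ctx n} → (P ∷ Γ) ⊩ varₗ zero ∶ P
    ⊩-weaken : ∀ {P Q} {Γ : Ctx n} {t} → Γ ⊩ t ∶ P → (Q ∷ Γ) ⊩ weaken t ∶ P
    ⊩-lift   : ∀ {P} {Γ : Ctx n} {t} → Γ ⊩ t ∶ P → Γ ⊢ lift t ∶ P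

  open TermApp l using (_/_)

  infix 4 _⊩ₛ_∶_

  _⊩ₛ_∶_ : Ctx n → Sub T m n → Ctx m → Set
  Δ ⊩ₛ ρ ∶ Γ = ∀ x → Δ ⊩ lookup ρ x ∶ lookup Γ x

  ⊩ₛ-↑ : ∀ {Γ : Ctx m} {Δ : Ctx n} {ρ P} →
         Δ ⊩ₛ ρ ∶ Γ → (P ∷ Δ) ⊩ₛ ρ ↑ ∶ (P ∷ Γ)
  ⊩ₛ-↑ ⊩ρ zero = ⊩-var
  ⊩ₛ-↑ {Γ = Γ} {Δ} {ρ} {P} ⊩ρ (suc x) =
    -- Past its head, `ρ ↑` is `ρ` mapped with `weaken`.
    subst ((P ∷ Δ) ⊩_∶ lookup Γ x) (sym (lookup-map x weaken ρ))
          (⊩-weaken (⊩ρ x))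

  ⊢-/ : ∀ {Γ : Ctx m} {Δ : Ctx n} {ρ t P} →
        Γ ⊢ t ∶ P → Δ ⊩ₛ ρ ∶ Γ → Δ ⊢ t / ρ ∶ P
  ⊢-/ (ax x)       ⊩ρ = ⊩-lift (⊩ρ x)
  ⊢-/ (abs st d e) ⊩ρ = abs st (⊢-/ d ⊩ρ) (⊢-/ e ⊩ρ)
  ⊢-/ (I∧⁺ d e)    ⊩ρ = I∧⁺ (⊢-/ d ⊩ρ) (⊢-/ e ⊩ρ)
  ⊢-/ (I∨⁻ d e)    ⊩ρ = I∨⁻ (⊢-/ d ⊩ρ) (⊢-/ e ⊩ρ)
  ⊢-/ (E∧⁺ i d)    ⊩ρ = E∧⁺ i (⊢-/ d ⊩ρ)
  ⊢-/ (E∨⁻ i d)    ⊩ρ = E∨⁻ i (⊢-/ d ⊩ρ)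
  ⊢-/ (I∨⁺ i d)    ⊩ρ = I∨⁺ i (⊢-/ d ⊩ρ)
  ⊢-/ (I∧⁻ i d)    ⊩ρ = I∧⁻ i (⊢-/ d ⊩ρ)
  ⊢-/ (E∨⁺ d e f)  ⊩ρ = E∨⁺ (⊢-/ d ⊩ρ) (⊢-/ e (⊩ₛ-↑ ⊩ρ)) (⊢-/ f (⊩ₛ-↑ ⊩ρ))
  ⊢-/ (E∧⁻ d e f)  ⊩ρ = E∧⁻ (⊢-/ d ⊩ρ) (⊢-/ e (⊩ₛ-↑ ⊩ρ)) (⊢-/ f (⊩ₛ-↑ ⊩ρ))
  ⊢-/ (I¬⁺ d)      ⊩ρ = I¬⁺ (⊢-/ d ⊩ρ)
  ⊢-/ (I¬⁻ d)      ⊩ρ = I¬⁻ (⊢-/ d ⊩ρ)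
  ⊢-/ (E¬⁺ d)      ⊩ρ = E¬⁺ (⊢-/ d ⊩ρ)
  ⊢-/ (E¬⁻ d)      ⊩ρ = E¬⁻ (⊢-/ d ⊩ρ)
  ⊢-/ (IC⁺ d)      ⊩ρ = IC⁺ (⊢-/ d (⊩ₛ-↑ ⊩ρ))
  ⊢-/ (IC⁻ d)      ⊩ρ = IC⁻ (⊢-/ d (⊩ₛ-↑ ⊩ρ))
  ⊢-/ (EC⁺ d e)    ⊩ρ = EC⁺ (⊢-/ d ⊩ρ) (⊢-/ e ⊩ρ)
  ⊢-/ (EC⁻ d e)    ⊩ρ = EC⁻ (⊢-/ d ⊩ρ) (⊢-/ e ⊩ρ)

open TermSubst termSubst using (varLift; termLift)

typedVarLift : TypedLift varLift
typedVarLift = record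
  { _⊩_∶_    = λ Γ x P → lookup Γ x ≡ P
  ; ⊩-var    = refl
  ; ⊩-weaken = λ eq → eq
  ; ⊩-lift   = λ { refl → ax _ }
  }

termLemmas₁ : Lemmas₁ Term
termLemmas₁ = record
  { lemmas₀    = record { simple = TermSubst.simple termSubst }
  ; weaken-var = cong var (VarLemmas.lookup-wk _)
  }

open Lemmas₁ termLemmas₁ using (lookup-id)

⊢-weaken : ∀ {Γ : Ctx n} {t P Q} →
           Γ ⊢ t ∶ P → (Q ∷ Γ) ⊢ Lift.weaken termLift t ∶ P
⊢-weaken {Γ = Γ} {Q = Q} d = TypedLift.⊢-/ typedVarLift d
  λ x → cong (lookup (Q ∷ Γ)) (VarLemmas.lookup-wk x)

typedTermLift : TypedLift termLift
typedTermLift = record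
  { _⊩_∶_    = _⊢_∶_
  ; ⊩-var    = ax zero
  ; ⊩-weaken = ⊢-weaken
  ; ⊩-lift   = λ d → d
  }

⊢-[] : ∀ {Γ : Ctx n} {t s P Q} → (P ∷ Γ) ⊢ t ∶ Q → Γ ⊢ s ∶ P → Γ ⊢ t [ s ] ∶ Q
⊢-[] {Γ = Γ} d e = TypedLift.⊢-/ typedTermLift d λ where
  zero    → e
  -- `sub s` is `s` followed by `id`, whose entries are built by iterated weakening and so equal
  -- variables only propositionally.
  (suc x) → subst (Γ ⊢_∶ lookup Γ x) (sym (lookup-id x)) (ax x)

data Mode : Set where
  s⁺ s⁻ c⁺ c⁻ : Mode

mode : Type → Mode
mode (A ⁺) = s⁺
mode (A ⁻) = s⁻
mode (A ⊕) = c⁺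
mode (A ⊖) = c⁻

-- Most terms show their mode in the head constructor and its sign. A variable reads its type from
-- `Γ`, an absurdity from its annotation. For `δ` the mode is that of a branch, and the binder
-- annotations force both derivations to extend `Γ` by the same type.
mode-unique : ∀ {Γ : Ctx n} {t P Q} → Γ ⊢ t ∶ P → Γ ⊢ t ∶ Q → mode P ≡ mode Q
mode-unique (ax x)      (ax .x)      = refl
mode-unique (abs _ _ _) (abs _ _ _)  = refl
mode-unique (I∧⁺ _ _)   (I∧⁺ _ _)    = refl
mode-unique (I∨⁻ _ _)   (I∨⁻ _ _)    = refl
mode-unique (E∧⁺ _ _)   (E∧⁺ _ _)    = refl
mode-unique (E∨⁻ _ _)   (E∨⁻ _ _)    = refl
mode-unique (I∨⁺ _ _)   (I∨⁺ _ _)    = refl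
mode-unique (I∧⁻ _ _)   (I∧⁻ _ _)    = refl
mode-unique (E∨⁺ _ d _) (E∨⁺ _ d′ _) = mode-unique d d′
mode-unique (E∧⁻ _ d _) (E∧⁻ _ d′ _) = mode-unique d d′
mode-unique (I¬⁺ _)     (I¬⁺ _)      = refl
mode-unique (I¬⁻ _)     (I¬⁻ _)      = refl
mode-unique (E¬⁺ _)     (E¬⁺ _)      = refl
mode-unique (E¬⁻ _)     (E¬⁻ _)      = refl
mode-unique (IC⁺ _)     (IC⁺ _)      = refl
mode-unique (IC⁻ _)     (IC⁻ _)      = refl
mode-unique (EC⁺ _ _)   (EC⁺ _ _)    = refl
mode-unique (EC⁻ _ _)   (EC⁻ _ _)    = refl

-- Equal modes make `_⋈[_⇒_]_` unfold to the same clause at `P′` as at `P`. In the classical modes,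
-- the two orders of `•` yield opposite strong types of the same proposition.
⊢-⋈ : ∀ {Γ : Ctx n} {t s P P′ Q} → mode P ≡ mode P′ →
      Γ ⊢ t ∶ P → Γ ⊢ s ∶ P ~ → Γ ⊢ t ⋈[ P′ ⇒ Q ] s ∶ Q
⊢-⋈ {P = A ⁺} {B ⁺} _ d e = abs strong⁺ d e
⊢-⋈ {P = A ⁻} {B ⁻} _ d e = abs strong⁻ d e
⊢-⋈ {P = A ⊕} {B ⊕} _ d e = abs strong⁺ (EC⁺ d e) (EC⁻ e d)
⊢-⋈ {P = A ⊖} {B ⊖} _ d e = abs strong⁻ (EC⁻ d e) (EC⁺ e d)

pick-⊢ : ∀ {Γ : Ctx n} {t₁ t₂ A₁ A₂} (m : PureProp → Type) i →
         Γ ⊢ t₁ ∶ m A₁ → Γ ⊢ t₂ ∶ m A₂ →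
         Γ ⊢ pick i t₁ t₂ ∶ m (pick i A₁ A₂)
pick-⊢ _ zero       d₁ d₂ = d₁
pick-⊢ _ (suc zero) d₁ d₂ = d₂

preservation-↦ : ∀ {Γ : Ctx n} {t s P} → Γ ⊢ t ∶ P → t ↦ s → Γ ⊢ s ∶ P
preservation-↦ (E∧⁺ i (I∧⁺ d e)) π-pair = pick-⊢ _⊕ i d e
preservation-↦ (E∨⁻ i (I∨⁻ d e)) π-pair = pick-⊢ _⊖ i d e
-- The branches live in different contexts, so `pick-⊢` does not apply and the index is split
-- instead.
preservation-↦ (E∨⁺ (I∨⁺ zero d) e f)       δ-inj = ⊢-[] e d
preservation-↦ (E∨⁺ (I∨⁺ (suc zero) d) e f) δ-inj = ⊢-[] f d
preservation-↦ (E∧⁻ (I∧⁻ zero d) e f)       δ-inj = ⊢-[] e d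
preservation-↦ (E∧⁻ (I∧⁻ (suc zero) d) e f) δ-inj = ⊢-[] f d
preservation-↦ (E¬⁺ (I¬⁺ d)) μ-ν = d
preservation-↦ (E¬⁻ (I¬⁻ d)) μ-ν = d
preservation-↦ (EC⁺ (IC⁺ d) e) IC-• = ⊢-[] d e
preservation-↦ (EC⁻ (IC⁻ d) e) IC-• = ⊢-[] d e
-- Primed derivations live in the context of the rule. There the component has a type `_⊕` as well
-- as the type chosen by the rule, so the latter has mode `c⁺`. That equation mentions no
-- proposition, hence also serves the types found in `Γ`.
preservation-↦ (abs _ (I∧⁺ d₁ d₂) (I∧⁻ i e)) (pair-inj _ (abs _ (I∧⁺ d₁′ d₂′) _) d′ _) =
  ⊢-⋈ (mode-unique (pick-⊢ _⊕ i d₁′ d₂′) d′) (pick-⊢ _⊕ i d₁ d₂) e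
preservation-↦ (abs _ (I∨⁻ d₁ d₂) (I∨⁺ i e)) (pair-inj _ (abs _ (I∨⁻ d₁′ d₂′) _) d′ _) =
  ⊢-⋈ (mode-unique (pick-⊢ _⊖ i d₁′ d₂′) d′) (pick-⊢ _⊖ i d₁ d₂) e
preservation-↦ (abs _ (I∨⁺ i d) (I∨⁻ e₁ e₂)) (inj-pair _ (abs _ (I∨⁺ _ d″) _) d′ _) =
  ⊢-⋈ (mode-unique d″ d′) d (pick-⊢ _⊖ i e₁ e₂)
preservation-↦ (abs _ (I∧⁻ i d) (I∧⁺ e₁ e₂)) (inj-pair _ (abs _ (I∧⁻ _ d″) _) d′ _) =
  ⊢-⋈ (mode-unique d″ d′) d (pick-⊢ _⊕ i e₁ e₂)
preservation-↦ (abs _ (I¬⁺ d) (I¬⁻ e)) (ν-ν _ (abs _ (I¬⁺ d″) _) d′ _) =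
  ⊢-⋈ (mode-unique d″ d′) d e
preservation-↦ (abs _ (I¬⁻ d) (I¬⁺ e)) (ν-ν _ (abs _ (I¬⁻ d″) _) d′ _) =
  ⊢-⋈ (mode-unique d″ d′) d e

-- Induction on the step, with `Γ` and `P` varying because `δ₁`, `δ₂` and `IC` recurse under a
-- binder.
preservation : ∀ {Γ : Ctx n} {t s P} → Γ ⊢ t ∶ P → t ⟶ s → Γ ⊢ s ∶ P
preservation d            (root r) = preservation-↦ d r
preservation (abs st d e) (▶◀ˡ r)  = abs st (preservation d r) e
preservation (abs st d e) (▶◀ʳ r)  = abs st d (preservation e r)
preservation (I∧⁺ d e)    (⟨⟩ˡ r)  = I∧⁺ (preservation d r) e
preservation (I∨⁻ d e)    (⟨⟩ˡ r)  = I∨⁻ (preservation d r) e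
preservation (I∧⁺ d e)    (⟨⟩ʳ r)  = I∧⁺ d (preservation e r)
preservation (I∨⁻ d e)    (⟨⟩ʳ r)  = I∨⁻ d (preservation e r)
preservation (E∧⁺ i d)    (π r)    = E∧⁺ i (preservation d r)
preservation (E∨⁻ i d)    (π r)    = E∨⁻ i (preservation d r)
preservation (I∨⁺ i d)    (inj r)  = I∨⁺ i (preservation d r)
preservation (I∧⁻ i d)    (inj r)  = I∧⁻ i (preservation d r)
preservation (E∨⁺ d e f)  (δ₀ r)   = E∨⁺ (preservation d r) e f
preservation (E∧⁻ d e f)  (δ₀ r)   = E∧⁻ (preservation d r) e f
preservation (E∨⁺ d e f)  (δ₁ r)   = E∨⁺ d (preservation e r) f
preservation (E∧⁻ d e f)  (δ₁ r)   = E∧⁻ d (preservation e r) f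
preservation (E∨⁺ d e f)  (δ₂ r)   = E∨⁺ d e (preservation f r)
preservation (E∧⁻ d e f)  (δ₂ r)   = E∧⁻ d e (preservation f r)
preservation (I¬⁺ d)      (ν r)    = I¬⁺ (preservation d r)
preservation (I¬⁻ d)      (ν r)    = I¬⁻ (preservation d r)
preservation (E¬⁺ d)      (μ r)    = E¬⁺ (preservation d r)
preservation (E¬⁻ d)      (μ r)    = E¬⁻ (preservation d r)
preservation (IC⁺ d)      (IC r)   = IC⁺ (preservation d r)
preservation (IC⁻ d)      (IC r)   = IC⁻ (preservation d r)
preservation (EC⁺ d e)    (•ˡ r)   = EC⁺ (preservation d r) e
preservation (EC⁻ d e)    (•ˡ r)   = EC⁻ (preservation d r) e
preservation (EC⁺ d e)    (•ʳ r)   = EC⁺ d (preservation e r)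
preservation (EC⁻ d e)    (•ʳ r)   = EC⁻ d (preservation e r)

proposition24 : ∀ {n : ℕ} (Γ : Ctx n) (t s : Term n) (P : Type) →
    Γ ⊢ t ∶ P → t ⟶ s → Γ ⊢ s ∶ P
proposition24 Γ t s P = preservation
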